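{- For every positive integer $n$: - if $n\equiv 0\pmod 4$, then $t(1,4,15;n)=2N(1,4,15;2n+5)$; - if $n\equiv 2\pmod 4$, then $t(1,12,15;n)=2N(1,12,15;2n+7)$; - if $n\equiv 2\pmod 4$, then $t(1,15,20;n)=2N(1,15,20;2n+9)$; - if $n\equiv 2\pmod 4$, then $t(3,4,45;n)=2N(3,4,45;2n+13)$.
   Context: For positive integers $a,b,c$ and $n\in\mathbb{N}=\{0,1,2,\dots\}$, $N(a,b,c;n)$ denotes the number of triples $(x,y,z)\in\mathbb{Z}^3$ with $n=ax^2+by^2+cz^2$, and $t(a,b,c;n)$ denotes the number of triples $(x,y,z)\in\mathbb{Z}^3$ with $n=a\frac{x(x+1)}2+b\frac{y(y+1)}2+c\frac{z(z+1)}2$. -}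

module Defs where

open import Data.Nat using (ℕ)
open import Data.Integer using (ℤ; _+_; _*_; +_)
open import Data.Product using (Σ; _×_)
open import Relation.Binary.PropositionalEquality using (_≡_)

-- Solutions (x,y,z) ∈ ℤ³ of  n = a x² + b y² + c z².
-- N(a,b,c;n) is the cardinality of this type.
Nsol : ℕ → ℕ → ℕ → ℕ → Set
Nsol a b c n = Σ (ℤ × ℤ × ℤ) λ { (x , y , z) →
  + n ≡ + a * (x * x) + + b * (y * y) + + c * (z * z) }
  where open Data.Product using (_,_)

-- Solutions (x,y,z) ∈ ℤ³ of  n = a x(x+1)/2 + b y(y+1)/2 + c z(z+1)/2,
-- written (multiplied by 2) as 2n = a x(x+1) + b y(y+1) + c z(z+1).
-- t(a,b,c;n) is the cardinality of this type.
tsol : ℕ → ℕ → ℕ → ℕ → Set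
tsol a b c n = Σ (ℤ × ℤ × ℤ) λ { (x , y , z) →
  + 2 * + n ≡ + a * (x * (x + + 1)) + + b * (y * (y + + 1)) + + c * (z * (z + + 1)) }
  where open Data.Product using (_,_)

{-# OPTIONS --safe #-}
module Submission where

-- With tri x = x(x+1), t counts the solutions of 2n = a tri x + b tri y + c tri z, and these are
-- matched with the representations of 2n + (a+b+c)/4. For (1,4,15): multiplying y + w√-15 by
-- 1 ± √-15 yields every solution of X² + 15Z² = 16K with X, Z, K odd, from exactly one sign and
-- one solution of y² + 15w² = K. In the other cases multiplication by (1 ± √-15)/2 identifies,
-- when 8 divides K, the odd solutions of X² + 15Z² = 4K with those of X² + 15Z² = K; then
-- multiplying y + w√-3 by 1 ± √-3 yields every odd solution of U² + 3V² = 4L, L odd, from exactly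
-- one sign and one solution of y² + 3w² = L.
module TernaryForms where

  open import Data.Bool using (Bool; true; false)
  open import Data.Empty using (⊥; ⊥-elim)
  open import Data.Integer
  open import Data.Integer.Divisibility.Signed using (_∣_; divides; ∣⇒∣ᵤ)
  open import Data.Integer.DivMod using (_/ℕ_; _%ℕ_; a≡a%ℕn+[a/ℕn]*n; n%ℕd<d)
  open import Data.Integer.Properties
  open import Data.Integer.Tactic.RingSolver using (solve-∀)
  open import Defs
  open import Algebra.Properties.AbelianGroup +-0-abelianGroup
    using () renaming (∙-cancelʳ to +-cancelʳ)
  open import Data.Fin using (Fin)
  open import Data.Fin.Properties using (2↔Bool; *↔×)
  import Data.Nat as ℕ
  import Data.Nat.DivMod as ℕ using (m≡m%n+[m/n]*n)
  import Data.Nat.Divisibility as ℕ using (∣1⇒≡1)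
  open import Data.Product using (Σ; ∃; _×_; _,_; proj₁; proj₂)
  open import Data.Sum using (_⊎_; inj₁; inj₂)
  open import Function.Base using (_∘_; case_of_)
  open import Function.Bundles using (_↔_; mk⤖)
  open import Function.Properties.Bijection using (⤖⇒↔)
  open import Function.Properties.Inverse using (↔-refl; ↔-sym; ↔-trans)
  open import Function.Related.Propositional using (bijection; module EquationalReasoning)
  open import Function.Related.TypeIsomorphisms using (Σ-assoc)
  open import Data.Product.Function.NonDependent.Propositional using (_×-cong_)
  open import Relation.Binary.PropositionalEquality
    using (_≡_; refl; sym; trans; cong; cong₂; subst; module ≡-Reasoning)
  open import Relation.Binary.PropositionalEquality.WithK using (≡-irrelevant)
  open import Relation.Nullary using (Irrelevant)

  -- Parity and divisibility by powers of two.

  Even Odd : ℤ → Set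
  Even x = ∃ λ h → x ≡ + 2 * h
  Odd x = ∃ λ h → x ≡ + 2 * h + + 1

  parity : ∀ x → Even x ⊎ Odd x
  parity x with x %ℕ 2 | n%ℕd<d x 2 | a≡a%ℕn+[a/ℕn]*n x 2
  ... | 0 | _ | eq = inj₁ (x /ℕ 2 , trans eq (ring (x /ℕ 2)))
    where
    ring : ∀ h → + 0 + h * + 2 ≡ + 2 * h
    ring = solve-∀
  ... | 1 | _ | eq = inj₂ (x /ℕ 2 , trans eq (ring (x /ℕ 2)))
    where
    ring : ∀ h → + 1 + h * + 2 ≡ + 2 * h + + 1
    ring = solve-∀
  ... | ℕ.suc (ℕ.suc _) | ℕ.s≤s (ℕ.s≤s ()) | _

  2i≢2j+1 : ∀ i j → + 2 * i ≡ + 2 * j + + 1 → ⊥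
  2i≢2j+1 i j eq with ℕ.∣1⇒≡1 (∣⇒∣ᵤ (divides (i - j) 1≡))
    where
    open ≡-Reasoning
    ring₁ : ∀ j → + 1 ≡ + 2 * j + + 1 - + 2 * j
    ring₁ = solve-∀
    ring₂ : ∀ i j → + 2 * i - + 2 * j ≡ (i - j) * + 2
    ring₂ = solve-∀
    1≡ : + 1 ≡ (i - j) * + 2
    1≡ = begin
      + 1                      ≡⟨ ring₁ j ⟩
      + 2 * j + + 1 - + 2 * j  ≡⟨ cong (_- + 2 * j) eq ⟨
      + 2 * i - + 2 * j        ≡⟨ ring₂ i j ⟩
      (i - j) * + 2            ∎
  ... | ()

  infix 8 2^_
  2^_ : ℕ.ℕ → ℤ
  2^ k = (+ 2) ^ k

  -- Induction on `k`: writing p = 2h + 1, both pq and 2hq are even, so q = pq - 2hq is even, and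
  -- one factor 2 cancels from the divisibility.
  odd-cancel : ∀ k {p q} → Odd p → 2^ k ∣ p * q → 2^ k ∣ q
  odd-cancel ℕ.zero {q = q} _ _ = divides q (sym (*-identityʳ q))
  odd-cancel (ℕ.suc k) {q = q} (h , refl) (divides c eq) =
    case odd-cancel k (h , refl) (divides c half) of λ where
      (divides c′ eq′) → divides c′ (trans q≡ (trans (cong (λ t → + 2 * t) eq′) (ring₄ c′ (2^ k))))
    where
    open ≡-Reasoning
    q′ = c * 2^ k - h * q
    ring₁ : ∀ h q → q ≡ (+ 2 * h + + 1) * q - + 2 * h * q
    ring₁ = solve-∀
    ring₂ : ∀ c r h q → c * (+ 2 * r) - + 2 * h * q ≡ + 2 * (c * r - h * q)
    ring₂ = solve-∀
    ring₃ : ∀ h q → + 2 * ((+ 2 * h + + 1) * q) ≡ (+ 2 * h + + 1) * (+ 2 * q)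
    ring₃ = solve-∀
    ring₄ : ∀ c r → + 2 * (c * r) ≡ c * (+ 2 * r)
    ring₄ = solve-∀
    q≡ : q ≡ + 2 * q′
    q≡ = begin
      q                                    ≡⟨ ring₁ h q ⟩
      (+ 2 * h + + 1) * q - + 2 * h * q    ≡⟨ cong (_- + 2 * h * q) eq ⟩
      c * (+ 2 * 2^ k) - + 2 * h * q    ≡⟨ ring₂ c (2^ k) h q ⟩
      + 2 * q′                             ∎
    half : (+ 2 * h + + 1) * q′ ≡ c * 2^ k
    half = *-cancelˡ-≡ (+ 2) _ _ (begin
      + 2 * ((+ 2 * h + + 1) * q′)  ≡⟨ ring₃ h q′ ⟩
      (+ 2 * h + + 1) * (+ 2 * q′)  ≡⟨ cong ((+ 2 * h + + 1) *_) q≡ ⟨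
      (+ 2 * h + + 1) * q           ≡⟨ eq ⟩
      c * (+ 2 * 2^ k)           ≡⟨ ring₄ c (2^ k) ⟨
      + 2 * (c * 2^ k)           ∎)

  2^-nonZero : ∀ k → NonZero (2^ k)
  2^-nonZero ℕ.zero = _
  2^-nonZero (ℕ.suc k) = i*j≢0 (+ 2) (2^ k) {{_}} {{2^-nonZero k}}

  -- The products x(x+1) and their symmetry.

  tri : ℤ → ℤ
  tri x = x * (x + + 1)

  tri-even : ∀ x → Even (tri x)
  tri-even x with parity x
  ... | inj₁ (h , refl) = h * (+ 2 * h + + 1) , ring h
    where
    ring : ∀ h → + 2 * h * (+ 2 * h + + 1) ≡ + 2 * (h * (+ 2 * h + + 1))
    ring = solve-∀
  ... | inj₂ (h , refl) = (+ 2 * h + + 1) * (h + + 1) , ring h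
    where
    ring : ∀ h → (+ 2 * h + + 1) * (+ 2 * h + + 1 + + 1) ≡ + 2 * ((+ 2 * h + + 1) * (h + + 1))
    ring = solve-∀

  -- In the odd variable U = 2u + 1 these two maps are U and -U, which is why `tri` does not
  -- distinguish them.
  signed : Bool → ℤ → ℤ
  signed true  u = u
  signed false u = - (u + + 1)

  tri-signed : ∀ ε u → tri (signed ε u) ≡ tri u
  tri-signed true  u = refl
  tri-signed false u = ring u
    where
    ring : ∀ u → - (u + + 1) * (- (u + + 1) + + 1) ≡ u * (u + + 1)
    ring = solve-∀

  -- Solution sets and bijections between them.

  module _ {A B : Set} {P : A → Set} {Q : B → Set}
           (P-irr : ∀ {a} → Irrelevant (P a)) (Q-irr : ∀ {b} → Irrelevant (Q b)) where

    -- Irrelevance of `P` and `Q` reduces equality in the subsets to equality of the underlying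
    -- elements. Surjectivity is asked only at points of `Q`, so that the equation being solved can
    -- supply the parity conditions describing the image of `f`.
    subset-↔ : (f : A → B) → (∀ a → P a → Q (f a)) → (∀ a → Q (f a) → P a) →
               (∀ a a′ → f a ≡ f a′ → a ≡ a′) → (∀ b → Q b → ∃ λ a → f a ≡ b) →
               Σ A P ↔ Σ B Q
    subset-↔ f P⇒Q Q⇒P f-inj f-surj = ⤖⇒↔ (mk⤖ {to = to} (inj , surj))
      where
      Σ-≡ : ∀ {C : Set} {R : C → Set} → (∀ {c} → Irrelevant (R c)) →
            {s t : Σ C R} → proj₁ s ≡ proj₁ t → s ≡ t
      Σ-≡ irr {c , r} {.c , r′} refl = cong (c ,_) (irr r r′)

      to : Σ A P → Σ B Q
      to (a , p) = f a , P⇒Q a p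

      inj : ∀ {s t} → to s ≡ to t → s ≡ t
      inj {a , _} {a′ , _} eq = Σ-≡ P-irr (f-inj a a′ (cong proj₁ eq))

      surj : ∀ t → ∃ λ s → ∀ {s′} → s′ ≡ s → to s′ ≡ t
      surj (b , q) with f-surj b q
      ... | a , refl = (a , Q⇒P a q) , λ { refl → Σ-≡ Q-irr refl }

  -- One function per variable allows the intermediate equations to mix `tri` terms with squares,
  -- and an integer `m` allows shifts such as κ - 3a without sign conditions.
  Sol : ℤ → (ℤ → ℤ) → (ℤ → ℤ) → (ℤ → ℤ) → Set
  Sol m f g h = Σ (ℤ × ℤ × ℤ) λ (x , y , z) → m ≡ f x + g y + h z

  infix 7 _·tri _·sq
  _·tri _·sq : ℤ → ℤ → ℤ
  (a ·tri) x = a * tri x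
  (a ·sq) x = a * (x * x)

  Sol-cong : ∀ {m m′} f g h → m ≡ m′ → Sol m f g h ↔ Sol m′ f g h
  Sol-cong _ _ _ refl = ↔-refl

  swap₁₂ : ∀ {m} f g h → Sol m f g h ↔ Sol m g f h
  swap₁₂ f g h = subset-↔ ≡-irrelevant ≡-irrelevant
    (λ (x , y , z) → y , x , z)
    (λ (x , y , z) e → trans e (cong (_+ h z) (+-comm (f x) (g y))))
    (λ (x , y , z) e → trans e (cong (_+ h z) (+-comm (g y) (f x))))
    (λ { _ _ refl → refl })
    (λ (x , y , z) _ → (y , x , z) , refl)

  swap₂₃ : ∀ {m} f g h → Sol m f g h ↔ Sol m f h g
  swap₂₃ f g h = subset-↔ ≡-irrelevant ≡-irrelevant
    (λ (x , y , z) → x , z , y)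
    (λ (x , y , z) e → trans e (ring (f x) (g y) (h z)))
    (λ (x , y , z) e → trans e (ring (f x) (h z) (g y)))
    (λ { _ _ refl → refl })
    (λ (x , y , z) _ → (x , z , y) , refl)
    where
    ring : ∀ a b c → a + b + c ≡ a + c + b
    ring = solve-∀

  -- Choice of sign and multiplication in imaginary quadratic rings.

  -- For r ≠ 0 these are the solutions with x ≡ z (mod r), where x is recorded by the quotient w =
  -- (z - x)/r.
  Paired : ℤ → ℤ → ℤ → ℤ → ℤ → Set
  Paired r m a b c = Σ (ℤ × ℤ × ℤ) λ (w , y , z) → m ≡ a * tri (z - r * w) + b * tri y + c * tri z

  -- With X = 2x+1 and Z = 2z+1, the hypothesis says X² ≡ Z² (mod 4r) for r = 2ᵏ⁺¹.
  -- As one of X - Z, X + Z is 2 mod 4, there is exactly one sign with X ≡ ± Z (mod 2r).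
  pairing : ∀ k {m a b c} →
    (∀ x y z → m ≡ a * tri x + b * tri y + c * tri z → 2^ ℕ.suc k ∣ tri x - tri z) →
    Sol m (a ·tri) (b ·tri) (c ·tri) ↔ (Bool × Paired (2^ ℕ.suc k) m a b c)
  pairing k {m} {a} {b} {c} congruent =
    ↔-sym (↔-trans (↔-sym Σ-assoc) (subset-↔ ≡-irrelevant ≡-irrelevant to to-sol from-sol to-inj to-surj))
    where
    open ≡-Reasoning
    ρ = 2^ k
    r = 2^ ℕ.suc k

    to : Bool × ℤ × ℤ × ℤ → ℤ × ℤ × ℤ
    to (ε , w , y , z) = signed ε (z - r * w) , y , z

    same : ∀ ε w y z → a * tri (z - r * w) + b * tri y + c * tri z
                     ≡ a * tri (signed ε (z - r * w)) + b * tri y + c * tri z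
    same ε w y z = cong (λ t → a * t + b * tri y + c * tri z) (sym (tri-signed ε (z - r * w)))

    to-sol : ∀ s → _
    to-sol (ε , w , y , z) e = trans e (same ε w y z)

    from-sol : ∀ s → _
    from-sol (ε , w , y , z) e = trans e (sym (same ε w y z))

    ring₁ : ∀ z v → v ≡ z - (z - v)
    ring₁ = solve-∀
    ring₂ : ∀ z v → v ≡ z + (- (z - v + + 1) + + 1)
    ring₂ = solve-∀
    ring₃ : ∀ z ρ w → + 2 * (ρ * w - z) ≡ - z - (z - + 2 * ρ * w)
    ring₃ = solve-∀
    ring₄ : ∀ z ρ w → - z - - (z - + 2 * ρ * w + + 1) ≡ + 2 * (- (ρ * w)) + + 1
    ring₄ = solve-∀

    -- The two signs never give the same x: `r` is even, so the left side has the parity of z and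
    -- the right side the opposite parity.
    clash : ∀ z w w′ → z - r * w ≡ - (z - r * w′ + + 1) → ⊥
    clash z w w′ eq = 2i≢2j+1 (ρ * w - z) (- (ρ * w′))
      (trans (ring₃ z ρ w) (trans (cong (λ t → - z - t) eq) (ring₄ z ρ w′)))

    cancel : ∀ w w′ → r * w ≡ r * w′ → w ≡ w′
    cancel w w′ = *-cancelˡ-≡ r w w′ {{2^-nonZero (ℕ.suc k)}}

    to-inj : ∀ s s′ → to s ≡ to s′ → s ≡ s′
    to-inj (ε , w , y , z) (ε′ , w′ , y′ , z′) eq with cong (proj₁ ∘ proj₂) eq | cong (proj₂ ∘ proj₂) eq
    to-inj (true , w , y , z) (true , w′ , y , z) eq | refl | refl =
      cong (λ w → true , w , y , z) (cancel w w′
        (trans (ring₁ z (r * w)) (trans (cong (λ t → z - t) (cong proj₁ eq)) (sym (ring₁ z (r * w′))))))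
    to-inj (false , w , y , z) (false , w′ , y , z) eq | refl | refl =
      cong (λ w → false , w , y , z) (cancel w w′
        (trans (ring₂ z (r * w)) (trans (cong (λ t → z + (t + + 1)) (cong proj₁ eq)) (sym (ring₂ z (r * w′))))))
    to-inj (true , w , y , z) (false , w′ , y , z) eq | refl | refl = ⊥-elim (clash z w w′ (cong proj₁ eq))
    to-inj (false , w , y , z) (true , w′ , y , z) eq | refl | refl = ⊥-elim (clash z w′ w (sym (cong proj₁ eq)))

    ring₅ : ∀ x z → x * (x + + 1) - z * (z + + 1) ≡ (x - z) * (x + z + + 1)
    ring₅ = solve-∀
    ring₆ : ∀ x z → x + z + + 1 ≡ x - z + (+ 2 * z + + 1)
    ring₆ = solve-∀
    ring₇ : ∀ z h → + 2 * h + (+ 2 * z + + 1) ≡ + 2 * (h + z) + + 1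
    ring₇ = solve-∀
    ring₈ : ∀ z c r → z - r * (- c) ≡ z + c * r
    ring₈ = solve-∀
    ring₉ : ∀ x z → z + (x - z) ≡ x
    ring₉ = solve-∀
    ring₁₀ : ∀ z c r → - (z - r * c + + 1) ≡ c * r - (z + + 1)
    ring₁₀ = solve-∀
    ring₁₁ : ∀ x z → x + z + + 1 - (z + + 1) ≡ x
    ring₁₁ = solve-∀

    minus : ∀ x y z → r ∣ x - z → ∃ λ s → to s ≡ (x , y , z)
    minus x y z (divides c eq) = (true , - c , y , z) , cong (_, y , z) (begin
      z - r * (- c)  ≡⟨ ring₈ z c r ⟩
      z + c * r      ≡⟨ cong (λ t → z + t) eq ⟨
      z + (x - z)    ≡⟨ ring₉ x z ⟩
      x              ∎)

    plus : ∀ x y z → r ∣ x + z + + 1 → ∃ λ s → to s ≡ (x , y , z)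
    plus x y z (divides c eq) = (false , c , y , z) , cong (_, y , z) (begin
      - (z - r * c + + 1)        ≡⟨ ring₁₀ z c r ⟩
      c * r - (z + + 1)          ≡⟨ cong (_- (z + + 1)) eq ⟨
      x + z + + 1 - (z + + 1)    ≡⟨ ring₁₁ x z ⟩
      x                          ∎)

    to-surj : ∀ t → _ → ∃ λ s → to s ≡ t
    to-surj (x , y , z) e with subst (r ∣_) (ring₅ x z) (congruent x y z e) | parity (x - z)
    ... | r∣ | inj₂ odd = plus x y z (odd-cancel (ℕ.suc k) odd r∣)
    ... | r∣ | inj₁ (h , eq) = minus x y z (odd-cancel (ℕ.suc k)
      (h + z , trans (ring₆ x z) (trans (cong (_+ (+ 2 * z + + 1)) eq) (ring₇ z h)))
      (subst (r ∣_) (*-comm (x - z) (x + z + + 1)) r∣))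

  -- For s = (1 + d)/4, r = 2s, X = 2x+1, Z = 2z+1 and Y = Z - w, the substitution X = ± (Z - 2rw)
  -- of pairing says that X + Z√-d is (Y + w√-d)(1 + √-d) or minus its conjugate.
  norm-pairs : ∀ k {κ p q} → let d = + 4 * 2^ k - + 1 in Even κ → Odd q →
    Sol (2^ k * κ) (q ·tri) ((2^ k * p) ·tri) ((d * q) ·tri) ↔
    (Bool × Sol (κ + q) (p ·tri) (q ·sq) ((d * q) ·sq))
  norm-pairs k {κ} {p} {q} (κ′ , κ≡) odd@(j , q≡) =
    ↔-trans (pairing k {a = q} {s * p} {d * q} congruent) (↔-refl ×-cong subset-↔ ≡-irrelevant ≡-irrelevant to to-sol from-sol to-inj to-surj)
    where
    open ≡-Reasoning
    s = 2^ k
    d = + 4 * s - + 1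

    ring₁ : ∀ s p q t u v → q * (t - v) ≡
      q * t + s * p * u + (+ 4 * s - + 1) * q * v - s * p * u - + 4 * s * q * v
    ring₁ = solve-∀
    ring₂ : ∀ s κ p q t v → s * (+ 2 * κ) - s * p * (+ 2 * t) - + 4 * s * q * v ≡
      (κ - p * t - + 2 * q * v) * (+ 2 * s)
    ring₂ = solve-∀

    congruent : ∀ x y z → s * κ ≡ q * tri x + s * p * tri y + d * q * tri z → + 2 * s ∣ tri x - tri z
    congruent x y z e with tri-even y
    -- Since dq = 4sq - q, the equation expresses q(tri x - tri z) through sκ, sp·tri y and 4sq·tri
    -- z. Each is divisible by 2s because κ and tri y are even; then the odd q cancels.
    ... | t , t≡ = odd-cancel (ℕ.suc k) odd (divides (κ′ - p * t - + 2 * q * tri z) (begin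
      q * (tri x - tri z)
        ≡⟨ ring₁ s p q (tri x) (tri y) (tri z) ⟩
      q * tri x + s * p * tri y + d * q * tri z - s * p * tri y - + 4 * s * q * tri z
        ≡⟨ cong (λ t → t - s * p * tri y - + 4 * s * q * tri z) e ⟨
      s * κ - s * p * tri y - + 4 * s * q * tri z
        ≡⟨ cong₂ (λ κ t → s * κ - s * p * t - + 4 * s * q * tri z) κ≡ t≡ ⟩
      s * (+ 2 * κ′) - s * p * (+ 2 * t) - + 4 * s * q * tri z
        ≡⟨ ring₂ s κ′ p q t (tri z) ⟩
      (κ′ - p * t - + 2 * q * tri z) * (+ 2 * s)  ∎))

    to : ℤ × ℤ × ℤ → ℤ × ℤ × ℤ
    to (w , y , z) = y , + 2 * z + + 1 - w , w

    quad : ℤ × ℤ × ℤ → ℤ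
    quad (x , y , z) = p * tri x + q * (y * y) + d * q * (z * z)

    -- The norm of 1 + √-d is 1 + d = 4s, hence X² + dZ² = 4s(Y² + dw²). Replacing X² and Z² by
    -- 4·tri x + 1 and 4·tri z + 1 produces the correction -q.
    ring₃ : ∀ s p q w y z →
      q * ((z - + 2 * s * w) * (z - + 2 * s * w + + 1)) + s * p * (y * (y + + 1))
        + (+ 4 * s - + 1) * q * (z * (z + + 1)) ≡
      s * (p * (y * (y + + 1)) + q * ((+ 2 * z + + 1 - w) * (+ 2 * z + + 1 - w))
        + (+ 4 * s - + 1) * q * (w * w) - q)
    ring₃ = solve-∀
    ring₄ : ∀ t q → t ≡ t - q + q
    ring₄ = solve-∀

    to-sol : ∀ a → _ → κ + q ≡ quad (to a)
    to-sol a@(w , y , z) e = trans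
      (cong (_+ q) (*-cancelˡ-≡ s κ (quad (to a) - q) {{2^-nonZero k}} (trans e (ring₃ s p q w y z))))
      (sym (ring₄ (quad (to a)) q))

    from-sol : ∀ a → κ + q ≡ quad (to a) → _
    from-sol a@(w , y , z) e = trans
      (cong (s *_) (+-cancelʳ q κ (quad (to a) - q) (trans e (ring₄ (quad (to a)) q))))
      (sym (ring₃ s p q w y z))

    ring₅ : ∀ z w → + 2 * z ≡ + 2 * z + + 1 - w + (w - + 1)
    ring₅ = solve-∀

    to-inj : ∀ a a′ → to a ≡ to a′ → a ≡ a′
    to-inj (w , y , z) (w′ , y′ , z′) eq with cong proj₁ eq | cong (proj₂ ∘ proj₂) eq
    ... | refl | refl = cong (λ z → w , y , z) (*-cancelˡ-≡ (+ 2) z z′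
      (trans (ring₅ z w) (trans (cong (_+ (w - + 1)) (cong (proj₁ ∘ proj₂) eq)) (sym (ring₅ z′ w)))))

    ring₆ : ∀ y w → y ≡ y + w - w
    ring₆ = solve-∀
    ring₇ : ∀ s p q t h w → + 2 * (p * t + q * (+ 2 * h * h - + 2 * h * w + + 2 * s * (w * w))) ≡
      p * (+ 2 * t) + q * ((+ 2 * h - w) * (+ 2 * h - w)) + (+ 4 * s - + 1) * q * (w * w)
    ring₇ = solve-∀
    ring₈ : ∀ κ j → + 2 * κ + (+ 2 * j + + 1) ≡ + 2 * (κ + j) + + 1
    ring₈ = solve-∀

    to-surj : ∀ b → κ + q ≡ quad b → ∃ λ a → to a ≡ b
    to-surj (x , y , w) e with parity (y + w) | tri-even x
    ... | inj₂ (h , eq) | _ =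
      (w , x , h) , cong (λ y → x , y , w) (sym (trans (ring₆ y w) (cong (_- w) eq)))
    -- The image of `to` requires y + w = 2z + 1. If y + w were even, then y² + dw² would be even as
    -- d is odd, and so would the whole right side, while κ + q is odd.
    ... | inj₁ (h , eq) | t , t≡ = ⊥-elim (2i≢2j+1 _ (κ′ + j) (begin
      + 2 * (p * t + q * (+ 2 * h * h - + 2 * h * w + + 2 * s * (w * w)))
        ≡⟨ ring₇ s p q t h w ⟩
      p * (+ 2 * t) + q * ((+ 2 * h - w) * (+ 2 * h - w)) + d * q * (w * w)
        ≡⟨ cong₂ (λ t y → p * t + q * (y * y) + d * q * (w * w)) t≡
             (trans (ring₆ y w) (cong (_- w) eq)) ⟨
      p * tri x + q * (y * y) + d * q * (w * w)
        ≡⟨ e ⟨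
      κ + q
        ≡⟨ cong₂ _+_ κ≡ q≡ ⟩
      + 2 * κ′ + (+ 2 * j + + 1)
        ≡⟨ ring₈ κ′ j ⟩
      + 2 * (κ′ + j) + + 1  ∎))

  -- In ℤ[(1+√-15)/2] this is multiplication by an element of norm 4, namely (1 ± √-15)/2,
  -- with the sign determined by U ≡ ± H (mod 4) for U = 2u+1 and H = 2h+1.
  quarter : ∀ {κ a b} → Odd κ → Odd a →
    Sol (+ 4 * κ) (a ·tri) ((+ 4 * b) ·tri) ((+ 15 * a) ·tri) ↔
    Sol (κ - + 3 * a) (a ·tri) (b ·tri) ((+ 15 * a) ·tri)
  quarter {κ} {a} {b} (κ′ , κ≡) odd = ↔-trans (pairing 1 {a = a} {+ 4 * b} {+ 15 * a} congruent₄) (↔-trans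
    (↔-refl ×-cong ↔-sym (subset-↔ ≡-irrelevant ≡-irrelevant to to-sol from-sol to-inj to-surj))
    (↔-sym (pairing 0 {a = a} {b} {+ 15 * a} congruent₂)))
    where
    open ≡-Reasoning

    ring₁ : ∀ a b t u v → a * (t - v) ≡ a * t + + 4 * b * u + + 15 * a * v - + 4 * (b * u + + 4 * a * v)
    ring₁ = solve-∀
    ring₂ : ∀ κ t → + 4 * κ - + 4 * t ≡ (κ - t) * + 4
    ring₂ = solve-∀

    congruent₄ : ∀ x y z → + 4 * κ ≡ a * tri x + + 4 * b * tri y + + 15 * a * tri z → + 4 ∣ tri x - tri z
    congruent₄ x y z e = odd-cancel 2 odd (divides (κ - (b * tri y + + 4 * a * tri z))
      (trans (ring₁ a b (tri x) (tri y) (tri z))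
        (trans (cong (_- + 4 * (b * tri y + + 4 * a * tri z)) (sym e)) (ring₂ κ _))))

    ring₃ : ∀ t u → + 2 * t - + 2 * u ≡ (t - u) * + 2
    ring₃ = solve-∀

    congruent₂ : ∀ x y z → _ → + 2 ∣ tri x - tri z
    congruent₂ x y z _ with tri-even x | tri-even z
    ... | t , t≡ | u , u≡ = divides (t - u) (trans (cong₂ _-_ t≡ u≡) (ring₃ t u))

    -- Here U = 2(h - 2j) + 1 = H - 4j. The image has Z = (U + H)/2 and X = Z - 8H = (U - 15H)/2,
    -- the coordinates of (U + H√-15)(1 + √-15)/2.
    to : ℤ × ℤ × ℤ → ℤ × ℤ × ℤ
    to (j , y , h) = + 2 * h + + 1 , y , h - j

    rhs : ℤ × ℤ × ℤ → ℤ
    rhs (j , y , h) = a * tri (h - + 2 * j) + b * tri y + + 15 * a * tri h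

    -- This is X² + 15Z² = 4(U² + 15H²) in terms of `tri`: the constants 1 + 15 = 16 on both sides
    -- leave the shift 3a.
    ring₄ : ∀ a b j y h →
      a * ((h - j - + 4 * (+ 2 * h + + 1)) * (h - j - + 4 * (+ 2 * h + + 1) + + 1))
        + + 4 * b * (y * (y + + 1)) + + 15 * a * ((h - j) * (h - j + + 1)) ≡
      + 4 * (a * ((h - + 2 * j) * (h - + 2 * j + + 1)) + b * (y * (y + + 1))
        + + 15 * a * (h * (h + + 1)) + + 3 * a)
    ring₄ = solve-∀
    ring₅ : ∀ κ a → κ ≡ κ - + 3 * a + + 3 * a
    ring₅ = solve-∀

    to-sol : ∀ s → κ - + 3 * a ≡ rhs s → _
    to-sol s@(j , y , h) e = trans
      (cong (λ t → + 4 * t) (trans (ring₅ κ a) (cong (_+ + 3 * a) e)))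
      (sym (ring₄ a b j y h))

    from-sol : ∀ s → _ → κ - + 3 * a ≡ rhs s
    from-sol s@(j , y , h) e = +-cancelʳ (+ 3 * a) (κ - + 3 * a) (rhs s)
      (trans (sym (ring₅ κ a)) (*-cancelˡ-≡ (+ 4) κ (rhs s + + 3 * a) (trans e (ring₄ a b j y h))))

    ring₆ : ∀ h j → j ≡ h - (h - j)
    ring₆ = solve-∀

    to-inj : ∀ s s′ → to s ≡ to s′ → s ≡ s′
    to-inj (j , y , h) (j′ , y′ , h′) eq
      with *-cancelˡ-≡ (+ 2) h h′ (+-cancelʳ (+ 1) _ _ (cong proj₁ eq)) | cong (proj₁ ∘ proj₂) eq
    ... | refl | refl = cong (λ j → j , y , h)
      (trans (ring₆ h j) (trans (cong (λ t → h - t) (cong (proj₂ ∘ proj₂) eq)) (sym (ring₆ h j′))))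

    ring₇ : ∀ a b w y z →
      a * ((z - + 4 * w) * (z - + 4 * w + + 1)) + + 4 * b * y + + 15 * a * (z * (z + + 1)) ≡
      + 4 * (b * y + a * (+ 4 * (z * z) - + 2 * (z * w) + + 4 * (w * w) + + 4 * z - w))
    ring₇ = solve-∀
    ring₈ : ∀ a b t h z →
      b * (+ 2 * t) + a * (+ 4 * (z * z) - + 2 * (z * (+ 2 * h)) + + 4 * ((+ 2 * h) * (+ 2 * h)) + + 4 * z - + 2 * h) ≡
      + 2 * (b * t + a * (+ 2 * (z * z) - + 2 * (z * h) + + 8 * (h * h) + + 2 * z - h))
    ring₈ = solve-∀

    to-surj : ∀ b → _ → ∃ λ s → to s ≡ b
    to-surj (w , y , z) e with parity w | tri-even y
    ... | inj₂ (h , refl) | _ = (h - z , y , h) , cong (λ z → + 2 * h + + 1 , y , z) (sym (ring₆ h z))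
    -- The quotient w has to be the odd number H. Dividing the equation by 4 writes κ as a sum that
    -- is even whenever w is even, contrary to κ odd.
    ... | inj₁ (h , refl) | t , t≡ = ⊥-elim (2i≢2j+1 _ κ′ (begin
      _
        ≡⟨ ring₈ a b t h z ⟨
      b * (+ 2 * t) + a * (+ 4 * (z * z) - + 2 * (z * (+ 2 * h)) + + 4 * ((+ 2 * h) * (+ 2 * h)) + + 4 * z - + 2 * h)
        ≡⟨ cong (λ t → b * t + a * (+ 4 * (z * z) - + 2 * (z * (+ 2 * h)) + + 4 * ((+ 2 * h) * (+ 2 * h)) + + 4 * z - + 2 * h)) t≡ ⟨
      b * tri y + a * (+ 4 * (z * z) - + 2 * (z * (+ 2 * h)) + + 4 * ((+ 2 * h) * (+ 2 * h)) + + 4 * z - + 2 * h)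
        ≡⟨ *-cancelˡ-≡ (+ 4) κ _ (trans e (ring₇ a b (+ 2 * h) (tri y) z)) ⟨
      κ
        ≡⟨ κ≡ ⟩
      + 2 * κ′ + + 1  ∎))

  -- From a mixed equation to three squares.

  -- Substitute X = 2x + 1 and Y = 2y. Conversely, 4m + p is odd and so are p and e, so exactly one
  -- of X, Y is odd. An odd Y with an even X would give e ≡ p (mod 4), which e ≡ p + 2 excludes.
  odd-even-squares : ∀ {m p e f} → Odd p → (∃ λ g → e ≡ p + + 2 + + 4 * g) →
    Sol m (p ·tri) (e ·sq) (f ·sq) ↔ Sol (+ 4 * m + p) (p ·sq) (e ·sq) ((+ 4 * f) ·sq)
  odd-even-squares {m} {f = f} (p′ , refl) (g , refl) =
    subset-↔ ≡-irrelevant ≡-irrelevant to to-sol from-sol to-inj to-surj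
    where
    p = + 2 * p′ + + 1
    e = p + + 2 + + 4 * g

    to : ℤ × ℤ × ℤ → ℤ × ℤ × ℤ
    to (x , y , z) = + 2 * x + + 1 , + 2 * y , z

    rhs : ℤ × ℤ × ℤ → ℤ
    rhs (x , y , z) = p * tri x + e * (y * y) + f * (z * z)

    ring₁ : ∀ p e f x y z →
      p * ((+ 2 * x + + 1) * (+ 2 * x + + 1)) + e * (+ 2 * y * (+ 2 * y)) + + 4 * f * (z * z) ≡
      + 4 * (p * (x * (x + + 1)) + e * (y * y) + f * (z * z)) + p
    ring₁ = solve-∀

    to-sol : ∀ s → m ≡ rhs s → _
    to-sol s@(x , y , z) eq = trans (cong (λ t → + 4 * t + p) eq) (sym (ring₁ p e f x y z))

    from-sol : ∀ s → _ → m ≡ rhs s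
    from-sol s@(x , y , z) eq =
      *-cancelˡ-≡ (+ 4) m (rhs s) (+-cancelʳ p _ _ (trans eq (ring₁ p e f x y z)))

    to-inj : ∀ s s′ → to s ≡ to s′ → s ≡ s′
    to-inj (x , y , z) (x′ , y′ , z′) eq
      with *-cancelˡ-≡ (+ 2) x x′ (+-cancelʳ (+ 1) _ _ (cong proj₁ eq))
         | *-cancelˡ-≡ (+ 2) y y′ (cong (proj₁ ∘ proj₂) eq)
         | cong (proj₂ ∘ proj₂) eq
    ... | refl | refl | refl = refl

    ring₂ : ∀ p e f h i z → + 2 * (+ 2 * (p * (h * h) + e * (i * i) + f * (z * z))) ≡
      p * (+ 2 * h * (+ 2 * h)) + e * (+ 2 * i * (+ 2 * i)) + + 4 * f * (z * z)
    ring₂ = solve-∀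
    ring₃ : ∀ m p → + 4 * m + (+ 2 * p + + 1) ≡ + 2 * (+ 2 * m + p) + + 1
    ring₃ = solve-∀
    ring₄ : ∀ p g f h i z →
      + 2 * ((+ 2 * p + + 1) * (+ 2 * (h * h + h)) + (+ 2 * p + + 1 + + 2 + + 4 * g) * (+ 2 * (i * i + i))
        + (+ 2 * p + + 2 + + 2 * g) + + 2 * (f * (z * z))) ≡
      (+ 2 * p + + 1) * ((+ 2 * h + + 1) * (+ 2 * h + + 1))
        + (+ 2 * p + + 1 + + 2 + + 4 * g) * ((+ 2 * i + + 1) * (+ 2 * i + + 1)) + + 4 * f * (z * z)
    ring₄ = solve-∀
    ring₅ : ∀ p g f h i z →
      p * (+ 2 * h * (+ 2 * h))
        + (p + + 2 + + 4 * g) * ((+ 2 * i + + 1) * (+ 2 * i + + 1)) + + 4 * f * (z * z) ≡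
      + 2 * (+ 2 * (p * (h * h) + (p + + 2 + + 4 * g) * (i * i + i) + g + f * (z * z)) + + 1) + p
    ring₅ = solve-∀
    ring₆ : ∀ m → + 4 * m ≡ + 2 * (+ 2 * m)
    ring₆ = solve-∀

    m-odd : + 4 * m + p ≡ + 2 * (+ 2 * m + p′) + + 1
    m-odd = ring₃ m p′

    to-surj : ∀ b → _ → ∃ λ s → to s ≡ b
    to-surj (x , y , z) eq with parity x | parity y
    ... | inj₂ (h , refl) | inj₁ (i , refl) = (h , i , z) , refl
    ... | inj₁ (h , refl) | inj₁ (i , refl) =
      ⊥-elim (2i≢2j+1 _ (+ 2 * m + p′) (trans (ring₂ p e f h i z) (trans (sym eq) m-odd)))
    ... | inj₂ (h , refl) | inj₂ (i , refl) =
      ⊥-elim (2i≢2j+1 _ (+ 2 * m + p′) (trans (ring₄ p′ g f h i z) (trans (sym eq) m-odd)))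
    -- Only this case needs the residue modulo 4: cancelling p leaves 4m = 2(2w + 1), so 2m would be
    -- odd.
    ... | inj₁ (h , refl) | inj₂ (i , refl) =
      let w = p * (h * h) + e * (i * i + i) + g + f * (z * z) in
      ⊥-elim (2i≢2j+1 m w (*-cancelˡ-≡ (+ 2) (+ 2 * m) (+ 2 * w + + 1) (trans (sym (ring₆ m))
        (+-cancelʳ p (+ 4 * m) (+ 2 * (+ 2 * w + + 1)) (trans eq (ring₅ p g f h i z))))))

  -- The four forms and the resulting counts.

  module _ where

    open EquationalReasoning {k = bijection}

    -- Taking s = 4 and d = 15 combines the coefficients 1 and 15 and divides the coefficient 4 by
    -- s. The remaining `tri` term then becomes the odd square.
    pairs-1-4-15 : ∀ ν → Sol (+ 8 * ν) (+ 1 ·tri) (+ 4 ·tri) (+ 15 ·tri) ↔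
      (Bool × Sol (+ 8 * ν + + 5) (+ 1 ·sq) (+ 4 ·sq) (+ 15 ·sq))
    pairs-1-4-15 ν = begin
      Sol (+ 8 * ν) (+ 1 ·tri) (+ 4 ·tri) (+ 15 ·tri)
        ↔⟨ Sol-cong (+ 1 ·tri) (+ 4 ·tri) (+ 15 ·tri) (ring₁ ν) ⟩
      Sol (+ 4 * (+ 2 * ν)) (+ 1 ·tri) (+ 4 ·tri) (+ 15 ·tri)
        ↔⟨ norm-pairs 2 {p = + 1} (ν , refl) (+ 0 , refl) ⟩
      (Bool × Sol (+ 2 * ν + + 1) (+ 1 ·tri) (+ 1 ·sq) (+ 15 ·sq))
        ↔⟨ ↔-refl ×-cong swap₂₃ (+ 1 ·tri) (+ 1 ·sq) (+ 15 ·sq) ⟩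
      (Bool × Sol (+ 2 * ν + + 1) (+ 1 ·tri) (+ 15 ·sq) (+ 1 ·sq))
        ↔⟨ ↔-refl ×-cong odd-even-squares {f = + 1} (+ 0 , refl) (+ 3 , refl) ⟩
      (Bool × Sol (+ 4 * (+ 2 * ν + + 1) + + 1) (+ 1 ·sq) (+ 15 ·sq) (+ 4 ·sq))
        ↔⟨ ↔-refl ×-cong Sol-cong (+ 1 ·sq) (+ 15 ·sq) (+ 4 ·sq) (ring₂ ν) ⟩
      (Bool × Sol (+ 8 * ν + + 5) (+ 1 ·sq) (+ 15 ·sq) (+ 4 ·sq))
        ↔⟨ ↔-refl ×-cong swap₂₃ (+ 1 ·sq) (+ 15 ·sq) (+ 4 ·sq) ⟩
      (Bool × Sol (+ 8 * ν + + 5) (+ 1 ·sq) (+ 4 ·sq) (+ 15 ·sq))  ∎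
      where
      ring₁ : ∀ ν → + 8 * ν ≡ + 4 * (+ 2 * ν)
      ring₁ = solve-∀
      ring₂ : ∀ ν → + 4 * (+ 2 * ν + + 1) + + 1 ≡ + 8 * ν + + 5
      ring₂ = solve-∀

    ring-8ν+4 : ∀ ν → + 8 * ν + + 4 ≡ + 4 * (+ 2 * ν + + 1)
    ring-8ν+4 = solve-∀

    -- `quarter` turns 12 into 3; then s = 1, d = 3 and q = 1 combine the coefficients 1 and 3,
    -- leaving 15 on the `tri` term.
    pairs-1-12-15 : ∀ ν → Sol (+ 8 * ν + + 4) (+ 1 ·tri) (+ 12 ·tri) (+ 15 ·tri) ↔
      (Bool × Sol (+ 8 * ν + + 4 + + 7) (+ 1 ·sq) (+ 12 ·sq) (+ 15 ·sq))
    pairs-1-12-15 ν = begin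
      Sol (+ 8 * ν + + 4) (+ 1 ·tri) (+ 12 ·tri) (+ 15 ·tri)
        ↔⟨ Sol-cong (+ 1 ·tri) (+ 12 ·tri) (+ 15 ·tri) (ring-8ν+4 ν) ⟩
      Sol (+ 4 * (+ 2 * ν + + 1)) (+ 1 ·tri) (+ 12 ·tri) (+ 15 ·tri)
        ↔⟨ quarter {b = + 3} (ν , refl) (+ 0 , refl) ⟩
      Sol (+ 2 * ν + + 1 - + 3) (+ 1 ·tri) (+ 3 ·tri) (+ 15 ·tri)
        ↔⟨ swap₂₃ (+ 1 ·tri) (+ 3 ·tri) (+ 15 ·tri) ⟩
      Sol (+ 2 * ν + + 1 - + 3) (+ 1 ·tri) (+ 15 ·tri) (+ 3 ·tri)
        ↔⟨ Sol-cong (+ 1 ·tri) (+ 15 ·tri) (+ 3 ·tri) (ring₁ ν) ⟩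
      Sol (+ 1 * (+ 2 * (ν - + 1))) (+ 1 ·tri) (+ 15 ·tri) (+ 3 ·tri)
        ↔⟨ norm-pairs 0 {p = + 15} (ν - + 1 , refl) (+ 0 , refl) ⟩
      (Bool × Sol (+ 2 * (ν - + 1) + + 1) (+ 15 ·tri) (+ 1 ·sq) (+ 3 ·sq))
        ↔⟨ ↔-refl ×-cong odd-even-squares {f = + 3} (+ 7 , refl) (- + 4 , refl) ⟩
      (Bool × Sol (+ 4 * (+ 2 * (ν - + 1) + + 1) + + 15) (+ 15 ·sq) (+ 1 ·sq) (+ 12 ·sq))
        ↔⟨ ↔-refl ×-cong Sol-cong (+ 15 ·sq) (+ 1 ·sq) (+ 12 ·sq) (ring₂ ν) ⟩
      (Bool × Sol (+ 8 * ν + + 4 + + 7) (+ 15 ·sq) (+ 1 ·sq) (+ 12 ·sq))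
        ↔⟨ ↔-refl ×-cong swap₁₂ (+ 15 ·sq) (+ 1 ·sq) (+ 12 ·sq) ⟩
      (Bool × Sol (+ 8 * ν + + 4 + + 7) (+ 1 ·sq) (+ 15 ·sq) (+ 12 ·sq))
        ↔⟨ ↔-refl ×-cong swap₂₃ (+ 1 ·sq) (+ 15 ·sq) (+ 12 ·sq) ⟩
      (Bool × Sol (+ 8 * ν + + 4 + + 7) (+ 1 ·sq) (+ 12 ·sq) (+ 15 ·sq))  ∎
      where
      ring₁ : ∀ ν → + 2 * ν + + 1 - + 3 ≡ + 1 * (+ 2 * (ν - + 1))
      ring₁ = solve-∀
      ring₂ : ∀ ν → + 4 * (+ 2 * (ν - + 1) + + 1) + + 15 ≡ + 8 * ν + + 4 + + 7
      ring₂ = solve-∀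

    -- `quarter` turns 20 into 5; then d = 3 is applied with q = 5, combining 5 and 15 and leaving 1
    -- on the `tri` term.
    pairs-1-15-20 : ∀ ν → Sol (+ 8 * ν + + 4) (+ 1 ·tri) (+ 15 ·tri) (+ 20 ·tri) ↔
      (Bool × Sol (+ 8 * ν + + 4 + + 9) (+ 1 ·sq) (+ 15 ·sq) (+ 20 ·sq))
    pairs-1-15-20 ν = begin
      Sol (+ 8 * ν + + 4) (+ 1 ·tri) (+ 15 ·tri) (+ 20 ·tri)
        ↔⟨ Sol-cong (+ 1 ·tri) (+ 15 ·tri) (+ 20 ·tri) (ring-8ν+4 ν) ⟩
      Sol (+ 4 * (+ 2 * ν + + 1)) (+ 1 ·tri) (+ 15 ·tri) (+ 20 ·tri)
        ↔⟨ swap₂₃ (+ 1 ·tri) (+ 15 ·tri) (+ 20 ·tri) ⟩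
      Sol (+ 4 * (+ 2 * ν + + 1)) (+ 1 ·tri) (+ 20 ·tri) (+ 15 ·tri)
        ↔⟨ quarter {b = + 5} (ν , refl) (+ 0 , refl) ⟩
      Sol (+ 2 * ν + + 1 - + 3) (+ 1 ·tri) (+ 5 ·tri) (+ 15 ·tri)
        ↔⟨ swap₁₂ (+ 1 ·tri) (+ 5 ·tri) (+ 15 ·tri) ⟩
      Sol (+ 2 * ν + + 1 - + 3) (+ 5 ·tri) (+ 1 ·tri) (+ 15 ·tri)
        ↔⟨ Sol-cong (+ 5 ·tri) (+ 1 ·tri) (+ 15 ·tri) (ring₁ ν) ⟩
      Sol (+ 1 * (+ 2 * (ν - + 1))) (+ 5 ·tri) (+ 1 ·tri) (+ 15 ·tri)
        ↔⟨ norm-pairs 0 {p = + 1} (ν - + 1 , refl) (+ 2 , refl) ⟩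
      (Bool × Sol (+ 2 * (ν - + 1) + + 5) (+ 1 ·tri) (+ 5 ·sq) (+ 15 ·sq))
        ↔⟨ ↔-refl ×-cong swap₂₃ (+ 1 ·tri) (+ 5 ·sq) (+ 15 ·sq) ⟩
      (Bool × Sol (+ 2 * (ν - + 1) + + 5) (+ 1 ·tri) (+ 15 ·sq) (+ 5 ·sq))
        ↔⟨ ↔-refl ×-cong odd-even-squares {f = + 5} (+ 0 , refl) (+ 3 , refl) ⟩
      (Bool × Sol (+ 4 * (+ 2 * (ν - + 1) + + 5) + + 1) (+ 1 ·sq) (+ 15 ·sq) (+ 20 ·sq))
        ↔⟨ ↔-refl ×-cong Sol-cong (+ 1 ·sq) (+ 15 ·sq) (+ 20 ·sq) (ring₂ ν) ⟩
      (Bool × Sol (+ 8 * ν + + 4 + + 9) (+ 1 ·sq) (+ 15 ·sq) (+ 20 ·sq))  ∎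
      where
      ring₁ : ∀ ν → + 2 * ν + + 1 - + 3 ≡ + 1 * (+ 2 * (ν - + 1))
      ring₁ = solve-∀
      ring₂ : ∀ ν → + 4 * (+ 2 * (ν - + 1) + + 5) + + 1 ≡ + 8 * ν + + 4 + + 9
      ring₂ = solve-∀

    -- `quarter` with a = 3 turns 4 into 1; then d = 3 and q = 1 combine this 1 with the 3, leaving
    -- 45 on the `tri` term.
    pairs-3-4-45 : ∀ ν → Sol (+ 8 * ν + + 4) (+ 3 ·tri) (+ 4 ·tri) (+ 45 ·tri) ↔
      (Bool × Sol (+ 8 * ν + + 4 + + 13) (+ 3 ·sq) (+ 4 ·sq) (+ 45 ·sq))
    pairs-3-4-45 ν = begin
      Sol (+ 8 * ν + + 4) (+ 3 ·tri) (+ 4 ·tri) (+ 45 ·tri)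
        ↔⟨ Sol-cong (+ 3 ·tri) (+ 4 ·tri) (+ 45 ·tri) (ring-8ν+4 ν) ⟩
      Sol (+ 4 * (+ 2 * ν + + 1)) (+ 3 ·tri) (+ 4 ·tri) (+ 45 ·tri)
        ↔⟨ quarter {b = + 1} (ν , refl) (+ 1 , refl) ⟩
      Sol (+ 2 * ν + + 1 - + 9) (+ 3 ·tri) (+ 1 ·tri) (+ 45 ·tri)
        ↔⟨ swap₁₂ (+ 3 ·tri) (+ 1 ·tri) (+ 45 ·tri) ⟩
      Sol (+ 2 * ν + + 1 - + 9) (+ 1 ·tri) (+ 3 ·tri) (+ 45 ·tri)
        ↔⟨ swap₂₃ (+ 1 ·tri) (+ 3 ·tri) (+ 45 ·tri) ⟩
      Sol (+ 2 * ν + + 1 - + 9) (+ 1 ·tri) (+ 45 ·tri) (+ 3 ·tri)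
        ↔⟨ Sol-cong (+ 1 ·tri) (+ 45 ·tri) (+ 3 ·tri) (ring₁ ν) ⟩
      Sol (+ 1 * (+ 2 * (ν - + 4))) (+ 1 ·tri) (+ 45 ·tri) (+ 3 ·tri)
        ↔⟨ norm-pairs 0 {p = + 45} (ν - + 4 , refl) (+ 0 , refl) ⟩
      (Bool × Sol (+ 2 * (ν - + 4) + + 1) (+ 45 ·tri) (+ 1 ·sq) (+ 3 ·sq))
        ↔⟨ ↔-refl ×-cong swap₂₃ (+ 45 ·tri) (+ 1 ·sq) (+ 3 ·sq) ⟩
      (Bool × Sol (+ 2 * (ν - + 4) + + 1) (+ 45 ·tri) (+ 3 ·sq) (+ 1 ·sq))
        ↔⟨ ↔-refl ×-cong odd-even-squares {f = + 1} (+ 22 , refl) (- + 11 , refl) ⟩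
      (Bool × Sol (+ 4 * (+ 2 * (ν - + 4) + + 1) + + 45) (+ 45 ·sq) (+ 3 ·sq) (+ 4 ·sq))
        ↔⟨ ↔-refl ×-cong Sol-cong (+ 45 ·sq) (+ 3 ·sq) (+ 4 ·sq) (ring₂ ν) ⟩
      (Bool × Sol (+ 8 * ν + + 4 + + 13) (+ 45 ·sq) (+ 3 ·sq) (+ 4 ·sq))
        ↔⟨ ↔-refl ×-cong swap₁₂ (+ 45 ·sq) (+ 3 ·sq) (+ 4 ·sq) ⟩
      (Bool × Sol (+ 8 * ν + + 4 + + 13) (+ 3 ·sq) (+ 45 ·sq) (+ 4 ·sq))
        ↔⟨ ↔-refl ×-cong swap₂₃ (+ 3 ·sq) (+ 45 ·sq) (+ 4 ·sq) ⟩
      (Bool × Sol (+ 8 * ν + + 4 + + 13) (+ 3 ·sq) (+ 4 ·sq) (+ 45 ·sq))  ∎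
      where
      ring₁ : ∀ ν → + 2 * ν + + 1 - + 9 ≡ + 1 * (+ 2 * (ν - + 4))
      ring₁ = solve-∀
      ring₂ : ∀ ν → + 4 * (+ 2 * (ν - + 4) + + 1) + + 45 ≡ + 8 * ν + + 4 + + 13
      ring₂ = solve-∀

    -- The sign in `Bool` accounts for the factor 2. In the four applications s = (a + b + c)/4,
    -- from completing the squares.
    tsol↔2k : ∀ a b c n s {m k} → + 2 * + n ≡ m →
      Sol m (+ a ·tri) (+ b ·tri) (+ c ·tri) ↔
        (Bool × Sol (m + + s) (+ a ·sq) (+ b ·sq) (+ c ·sq)) →
      Nsol a b c (2 ℕ.* n ℕ.+ s) ↔ Fin k → tsol a b c n ↔ Fin (2 ℕ.* k)
    tsol↔2k a b c n s {m} {k} eq pairs finite = begin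
      Sol (+ 2 * + n) (+ a ·tri) (+ b ·tri) (+ c ·tri)
        ↔⟨ Sol-cong (+ a ·tri) (+ b ·tri) (+ c ·tri) eq ⟩
      Sol m (+ a ·tri) (+ b ·tri) (+ c ·tri)
        ↔⟨ pairs ⟩
      (Bool × Sol (m + + s) (+ a ·sq) (+ b ·sq) (+ c ·sq))
        ↔⟨ ↔-refl ×-cong Sol-cong (+ a ·sq) (+ b ·sq) (+ c ·sq) (sym (trans (pos-+ (2 ℕ.* n) s) (cong (_+ + s) (trans (pos-* 2 n) eq)))) ⟩
      (Bool × Sol (+ (2 ℕ.* n ℕ.+ s)) (+ a ·sq) (+ b ·sq) (+ c ·sq))
        ↔⟨ ↔-sym 2↔Bool ×-cong finite ⟩
      (Fin 2 × Fin k)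
        ↔⟨ *↔× ⟨
      Fin (2 ℕ.* k)  ∎

  -- Residues of n modulo 4.

  pos-mod : ∀ n {r} → n ℕ.% 4 ≡ r → + n ≡ + r + + (n ℕ./ 4) * + 4
  pos-mod n refl = trans (cong +_ (ℕ.m≡m%n+[m/n]*n n 4))
    (trans (pos-+ (n ℕ.% 4) _) (cong (λ t → + (n ℕ.% 4) + t) (pos-* (n ℕ./ 4) 4)))

  n≡0⇒2n≡8ν : ∀ n → n ℕ.% 4 ≡ 0 → + 2 * + n ≡ + 8 * + (n ℕ./ 4)
  n≡0⇒2n≡8ν n eq = trans (cong (λ t → + 2 * t) (pos-mod n eq)) (ring (+ (n ℕ./ 4)))
    where
    ring : ∀ ν → + 2 * (+ 0 + ν * + 4) ≡ + 8 * ν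
    ring = solve-∀

  n≡2⇒2n≡8ν+4 : ∀ n → n ℕ.% 4 ≡ 2 → + 2 * + n ≡ + 8 * + (n ℕ./ 4) + + 4
  n≡2⇒2n≡8ν+4 n eq = trans (cong (λ t → + 2 * t) (pos-mod n eq)) (ring (+ (n ℕ./ 4)))
    where
    ring : ∀ ν → + 2 * (+ 2 + ν * + 4) ≡ + 8 * ν + + 4
    ring = solve-∀

open import Defs
open import Data.Nat using (ℕ; _+_; _*_; _%_; _≤_)
open import Data.Fin using (Fin)
open import Data.Product using (_×_)
open import Function.Bundles using (_↔_)
open import Relation.Binary.PropositionalEquality using (_≡_)

open import Data.Integer using (+_)
open import Data.Nat using (_/_)
open import Data.Product using (_,_)
open TernaryForms

theorem6p2 : (n : ℕ) → 1 ≤ n → (k : ℕ) →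
    (n % 4 ≡ 0 → Nsol 1 4 15 (2 * n + 5) ↔ Fin k → tsol 1 4 15 n ↔ Fin (2 * k))
    × (n % 4 ≡ 2 → Nsol 1 12 15 (2 * n + 7) ↔ Fin k → tsol 1 12 15 n ↔ Fin (2 * k))
    × (n % 4 ≡ 2 → Nsol 1 15 20 (2 * n + 9) ↔ Fin k → tsol 1 15 20 n ↔ Fin (2 * k))
    × (n % 4 ≡ 2 → Nsol 3 4 45 (2 * n + 13) ↔ Fin k → tsol 3 4 45 n ↔ Fin (2 * k))
theorem6p2 n _ k =
    (λ n≡0 → tsol↔2k 1 4 15 n 5 (n≡0⇒2n≡8ν n n≡0) (pairs-1-4-15 (+ (n / 4))))
  , (λ n≡2 → tsol↔2k 1 12 15 n 7 (n≡2⇒2n≡8ν+4 n n≡2) (pairs-1-12-15 (+ (n / 4))))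
  , (λ n≡2 → tsol↔2k 1 15 20 n 9 (n≡2⇒2n≡8ν+4 n n≡2) (pairs-1-15-20 (+ (n / 4))))
  , (λ n≡2 → tsol↔2k 3 4 45 n 13 (n≡2⇒2n≡8ν+4 n n≡2) (pairs-3-4-45 (+ (n / 4))))
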